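{- Let $f(n)=|S_n(3\mathrm{ - }\bar{1}\mathrm{ - }42,\,3\mathrm{ - }\bar{1}\mathrm{ - }24)|$ for $n\ge1$ and $f(0)=1$. Let $F_n$ be the Fibonacci numbers with $F_0=F_1=1$, and define, for $n\ge k+2$, \[ a(n,k)=\sum_{\substack{n_1,\dots,n_{k+1}\ge0\\ n_1+\dots+n_{k+1}=n-k-2}} F_{n_1}F_{n_2}\cdots F_{n_{k+1}}, \] with $a(n,k)=0$ otherwise. Let $X=(f(0),f(1),f(2),\dots)^T$, $F=(1,F_0,F_1,F_2,\dots)^T$ and $\mathbf{A}=(a(n,k))_{n,k\ge0}$ (strictly lower triangular with zero main diagonal). Then $X=(\mathbf{I}-\mathbf{A})^{ -1}F$, where $\mathbf{I}$ is the infinite identity matrix.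
   Context: $S_n(\pi,\pi')$ is the set of permutations in $\mathfrak{S}_n$ avoiding both patterns. $\sigma$ contains $3\mathrm{ - }\bar{1}\mathrm{ - }42$ if there are $i<j<n$ with $\sigma_{j+1}<\sigma_i<\sigma_j$ and no $k$ with $i<k<j$, $\sigma_k<\sigma_{j+1}$. $\sigma$ contains $3\mathrm{ - }\bar{1}\mathrm{ - }24$ if there are $i<j<n$ with $\sigma_j<\sigma_i<\sigma_{j+1}$ and no $k$ with $i<k<j$, $\sigma_k<\sigma_j$. -}

module Defs where

open import Data.Nat using (ℕ; zero; suc; _+_; _*_; _∸_; _≤?_)
open import Data.Fin as Fin using (Fin; toℕ)
open import Data.Vec using (Vec; lookup)
open import Data.List using (List; length; map; upTo)
open import Data.Nat.ListAction using (sum)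
open import Data.List.Relation.Unary.Unique.Propositional using (Unique)
open import Data.List.Membership.Propositional using (_∈_)
open import Data.Product using (Σ; _×_; ∃-syntax)
open import Function.Bundles using (_⇔_)
open import Relation.Binary.PropositionalEquality using (_≡_)
open import Relation.Nullary using (¬_; yes; no)

IsPerm : {n : ℕ} → Vec (Fin n) n → Set
IsPerm {n} σ = (i j : Fin n) → lookup σ i ≡ lookup σ j → i ≡ j

Contains3b142 : {n : ℕ} → Vec (Fin n) n → Set
Contains3b142 {n} σ =
  ∃[ i ] ∃[ j ] ∃[ j′ ]
    ( toℕ j′ ≡ suc (toℕ j) × toℕ i Data.Nat.< toℕ j
    × lookup σ j′ Fin.< lookup σ i × lookup σ i Fin.< lookup σ j
    × ((k : Fin n) → toℕ i Data.Nat.< toℕ k → toℕ k Data.Nat.< toℕ j →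
         ¬ (lookup σ k Fin.< lookup σ j′)) )

Contains3b124 : {n : ℕ} → Vec (Fin n) n → Set
Contains3b124 {n} σ =
  ∃[ i ] ∃[ j ] ∃[ j′ ]
    ( toℕ j′ ≡ suc (toℕ j) × toℕ i Data.Nat.< toℕ j
    × lookup σ j Fin.< lookup σ i × lookup σ i Fin.< lookup σ j′
    × ((k : Fin n) → toℕ i Data.Nat.< toℕ k → toℕ k Data.Nat.< toℕ j →
         ¬ (lookup σ k Fin.< lookup σ j)) )

InS : {n : ℕ} → Vec (Fin n) n → Set
InS σ = IsPerm σ × ¬ Contains3b142 σ × ¬ Contains3b124 σ

IsCountS : ℕ → ℕ → Set
IsCountS n m = Σ (List (Vec (Fin n) n)) λ L →
  Unique L × length L ≡ m × ((σ : Vec (Fin n) n) → (σ ∈ L) ⇔ InS σ)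

fib : ℕ → ℕ
fib zero = 1
fib (suc zero) = 1
fib (suc (suc n)) = fib (suc n) + fib n

Σ< : ℕ → (ℕ → ℕ) → ℕ
Σ< n g = sum (map g (upTo n))

-- compSum p t = Σ over (n_1,…,n_p) ≥ 0 with n_1+…+n_p = t of F_{n_1}⋯F_{n_p}
compSum : ℕ → ℕ → ℕ
compSum zero zero = 1
compSum zero (suc t) = 0
compSum (suc p) t = Σ< (suc t) (λ m → fib m * compSum p (t ∸ m))

a : ℕ → ℕ → ℕ
a n k with suc (suc k) ≤? n
... | yes _ = compSum (suc k) (n ∸ suc (suc k))
... | no _ = 0

Fvec : ℕ → ℕ
Fvec zero = 1
Fvec (suc n) = fib n

{-# OPTIONS --safe #-}
module Submission where

-- Write S_n for the avoiding permutations and let h s d count those in S_{s+d+1} whose first entry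
-- exceeds exactly s of the others.
-- Deleting the first entry v leaves some τ in S_{s+d} admissible at the cut between the values
-- v - 1 and v: each adjacent pair of τ crossing the cut is preceded by something smaller than both.
-- In a permutation of S_n the entries up to the position of 0 decrease, and they lie below every
-- cut v ≥ 1 at which it is admissible. Hence τ is admissible at the cut v + 2 iff it is
-- admissible at v + 1, or it starts with v + 1, or it starts with 0, v + 1, and these exclude each
-- other:
--   h (s+2) d = h (s+1) (d+1) + h (s+1) d + h s d,   h 0 n = h n 0 = f n,   h 1 (d+1) = 0.
-- The factor 1/(1-z-z²) of the Fibonacci numbers obeys the same recurrence, which gives
--   h (n+2) d = [d = 0] F_{n+1} + Σ_{i ≤ n} compSum (i+1) (n-i) f(d+i);   take d = 0.

open import Defs
open import Data.Empty using (⊥)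
open import Data.Fin as Fin using (Fin; zero; suc; toℕ; fromℕ<; inject₁; punchIn; punchOut)
open import Data.Fin.Properties as Fin
  using (toℕ-injective; toℕ-fromℕ<; toℕ<n; toℕ-inject₁; all?; any?; injective⇒≤;
         punchIn-injective; punchInᵢ≢i; punchIn-mono-≤; punchIn-cancel-≤; punchIn-punchOut;
         punchOut-injective)
open import Data.List using (List; []; _∷_; _++_; applyUpTo; filter; length; map)
open import Data.List.Membership.Propositional using (_∈_)
open import Data.List.Membership.Propositional.Properties
  using (∈-map⁺; ∈-map⁻; ∈-filter⁺; ∈-filter⁻; ++-∈⇔)
open import Data.List.Membership.Propositional.Properties.WithK using (unique∧set⇒bag)
open import Data.List.Properties using (length-map; length-++; map-upTo)
open import Data.List.Relation.Binary.BagAndSetEquality using (∼bag⇒↭)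
open import Data.List.Relation.Binary.Permutation.Propositional.Properties using (↭-length)
open import Data.List.Relation.Unary.All using ([])
open import Data.List.Relation.Unary.AllPairs using ([]; _∷_)
open import Data.List.Relation.Unary.Any using (here)
open import Data.List.Relation.Unary.Unique.Propositional using (Unique)
import Data.List.Relation.Unary.Unique.Propositional.Properties as Unique
open import Data.Nat
open import Data.Nat.ListAction using (sum)
open import Data.Nat.Properties
open import Data.Nat.Tactic.RingSolver using (solve-∀)
open import Data.Product using (Σ; ∃-syntax; _×_; _,_; proj₁; proj₂)
open import Data.Sum as Sum using (_⊎_; inj₁; inj₂)
open import Data.Unit using (⊤; tt)
open import Data.Vec as Vec using (Vec; []; _∷_; lookup; tabulate)
open import Data.Vec.Properties using (lookup-map; lookup∘tabulate; tabulate∘lookup; tabulate-cong)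
open import Function using (_∘_; _⇔_; mk⇔; Equivalence)
open import Relation.Binary.Definitions using (tri<; tri≈; tri>)
open import Relation.Binary.PropositionalEquality
open import Relation.Nullary
open import Relation.Nullary.Decidable using (map′; _→-dec_; ¬?)
open import Relation.Unary using (Decidable)

open ≡-Reasoning

-- Finite cardinalities

-- `IsCountS n m` unfolds to `Card InS m`, so the given counts enter without conversion.
Card : {A : Set} → (A → Set) → ℕ → Set
Card {A} P m = Σ (List A) λ L → Unique L × length L ≡ m × (∀ x → (x ∈ L) ⇔ P x)

module _ {A : Set} {P Q : A → Set} where
  open Equivalence

  Card-unique : ∀ {m m′} → (∀ x → P x ⇔ Q x) → Card P m → Card Q m′ → m ≡ m′
  Card-unique P⇔Q (_ , uL , refl , L⇔P) (_ , uM , refl , M⇔Q) =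
    ↭-length (∼bag⇒↭ (unique∧set⇒bag uL uM (λ {x} →
      mk⇔ (from (M⇔Q x) ∘ to (P⇔Q x) ∘ to (L⇔P x)) (from (L⇔P x) ∘ from (P⇔Q x) ∘ to (M⇔Q x)))))

  Card-⊎ : ∀ {m m′} → (∀ {x} → P x → ¬ Q x) → Card P m → Card Q m′ →
           Card (λ x → P x ⊎ Q x) (m + m′)
  Card-⊎ disj (L , uL , refl , L⇔P) (M , uM , refl , M⇔Q) =
    L ++ M ,
    Unique.++⁺ uL uM (λ {x} (x∈L , x∈M) → disj (to (L⇔P x) x∈L) (to (M⇔Q x) x∈M)) ,
    length-++ L ,
    λ x → mk⇔ (Sum.map (to (L⇔P x)) (to (M⇔Q x)) ∘ to ++-∈⇔)
              (from ++-∈⇔ ∘ Sum.map (from (L⇔P x)) (from (M⇔Q x)))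

  Card-filter : ∀ {m} (Q? : Decidable Q) (c : Card P m) →
                Card (λ x → P x × Q x) (length (filter Q? (proj₁ c)))
  Card-filter Q? (L , uL , _ , L⇔P) =
    filter Q? L , Unique.filter⁺ Q? uL , refl ,
    λ x → mk⇔ (λ x∈ → let x∈L , q = ∈-filter⁻ Q? x∈ in to (L⇔P x) x∈L , q)
              (λ (p , q) → ∈-filter⁺ Q? (from (L⇔P x) p) q)

module _ {A B : Set} {P : A → Set} {Q : B → Set} (g : A → B) where
  open Equivalence

  Card-image : ∀ {m} → (∀ {x y} → g x ≡ g y → x ≡ y) → (∀ {x} → P x → Q (g x)) →
               (∀ {y} → Q y → ∃[ x ] P x × y ≡ g x) → Card P m → Card Q m
  Card-image g-inj P⇒Q Q⇒P (L , uL , refl , L⇔P) =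
    map g L , Unique.map⁺ g-inj uL , length-map g L ,
    λ y → mk⇔ (λ y∈ → let x , x∈L , y≡gx = ∈-map⁻ g y∈ in
                 subst Q (sym y≡gx) (P⇒Q (to (L⇔P x) x∈L)))
              (λ q → let x , p , y≡gx = Q⇒P q in
                 subst (_∈ map g L) (sym y≡gx) (∈-map⁺ g (from (L⇔P x) p)))

-- Occurrences and cuts

val : ∀ {m n} → Vec (Fin m) n → Fin n → ℕ
val σ i = toℕ (lookup σ i)

-- Adj j a b: {a , b} = {j , j+1}; a is meant to carry the smaller of the two values.
data Adj {n} (j : Fin n) : Fin n → Fin n → Set where
  rise : ∀ {b} → toℕ b ≡ suc (toℕ j) → Adj j j b
  fall : ∀ {a} → toℕ a ≡ suc (toℕ j) → Adj j a j

Adj-suc : ∀ {n} {j a b : Fin n} → Adj j a b → Adj (suc j) (suc a) (suc b)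
Adj-suc (rise e) = rise (cong suc e)
Adj-suc (fall e) = fall (cong suc e)

adj? : ∀ {n} (j a b : Fin n) → Dec (Adj j a b)
adj? j a b with a Fin.≟ j | b Fin.≟ j
... | yes refl | yes refl = no λ { (rise e) → 1+n≢n (sym e) ; (fall e) → 1+n≢n (sym e) }
... | yes refl | no b≢j = map′ rise (λ { (rise e) → e ; (fall e) → contradiction refl b≢j }) (toℕ b ≟ suc (toℕ j))
... | no a≢j | yes refl = map′ fall (λ { (fall e) → e ; (rise e) → contradiction refl a≢j }) (toℕ a ≟ suc (toℕ j))
... | no a≢j | no b≢j = no λ { (rise e) → a≢j refl ; (fall e) → b≢j refl }

-- In both patterns the barred entry is compared with the smaller member of the adjacent pair.
-- Naming the pair by value, through `Adj`, merges the two conditions into one.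
Avoids : ∀ {n} → Vec (Fin n) n → Set
Avoids τ = ∀ i {j a b} → Adj j a b → toℕ i < toℕ j → val τ a < val τ i → val τ i < val τ b →
  ¬ (∀ k → toℕ i < toℕ k → toℕ k < toℕ j → ¬ val τ k < val τ a)

InS⇒Avoids : ∀ {n} (τ : Vec (Fin n) n) → InS τ → Avoids τ
InS⇒Avoids τ (_ , ¬142 , ¬124) i (rise e) i<j a<i i<b none = ¬124 (i , _ , _ , e , i<j , a<i , i<b , none)
InS⇒Avoids τ (_ , ¬142 , ¬124) i (fall e) i<j a<i i<b none = ¬142 (i , _ , _ , e , i<j , a<i , i<b , none)

Avoids⇒InS : ∀ {n} (τ : Vec (Fin n) n) → IsPerm τ → Avoids τ → InS τ
Avoids⇒InS τ perm av = perm ,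
  (λ (i , _ , _ , e , i<j , a<i , i<b , none) → av i (fall e) i<j a<i i<b none) ,
  (λ (i , _ , _ , e , i<j , a<i , i<b , none) → av i (rise e) i<j a<i i<b none)

-- The condition on τ under which a new first entry may be inserted between the values v - 1 and v.
Adm : ∀ {n} → ℕ → Vec (Fin n) n → Set
Adm v τ = ∀ j a b → Adj j a b → val τ a < v → v ≤ val τ b →
  ¬ (∀ k → toℕ k < toℕ j → ¬ val τ k < val τ a)

adm? : ∀ {n} v (τ : Vec (Fin n) n) → Dec (Adm v τ)
adm? v τ = all? λ j → all? λ a → all? λ b → adj? j a b →-dec (val τ a <? v →-dec (v ≤? val τ b →-dec
  ¬? (all? λ k → toℕ k <? toℕ j →-dec ¬? (val τ k <? val τ a))))

AdmS : ∀ {n} → ℕ → Vec (Fin n) n → Set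
AdmS v τ = InS τ × Adm v τ

-- Inserting a first entry

punchIn-mono-< : ∀ {n} v {x y : Fin n} → toℕ x < toℕ y → toℕ (punchIn v x) < toℕ (punchIn v y)
punchIn-mono-< v x<y = ≰⇒> (<⇒≱ x<y ∘ punchIn-cancel-≤ v _ _)

punchIn-cancel-< : ∀ {n} v {x y : Fin n} → toℕ (punchIn v x) < toℕ (punchIn v y) → toℕ x < toℕ y
punchIn-cancel-< v x<y = ≰⇒> (<⇒≱ x<y ∘ punchIn-mono-≤ v _ _)

punchIn-< : ∀ {n} (v : Fin (suc n)) {x : Fin n} → toℕ x < toℕ v → toℕ (punchIn v x) < toℕ v
punchIn-< (suc v) {zero}  _         = z<s
punchIn-< (suc v) {suc x} (s<s x<v) = s<s (punchIn-< v x<v)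

punchIn-> : ∀ {n} (v : Fin (suc n)) {x : Fin n} → toℕ v ≤ toℕ x → toℕ v < toℕ (punchIn v x)
punchIn-> zero            _         = z<s
punchIn-> (suc v) {suc x} (s≤s v≤x) = s<s (punchIn-> v v≤x)

punchIn-<⁻ : ∀ {n} (v : Fin (suc n)) {x : Fin n} → toℕ (punchIn v x) < toℕ v → toℕ x < toℕ v
punchIn-<⁻ v p<v = ≰⇒> (<-asym p<v ∘ punchIn-> v)

punchIn->⁻ : ∀ {n} (v : Fin (suc n)) {x : Fin n} → toℕ v < toℕ (punchIn v x) → toℕ v ≤ toℕ x
punchIn->⁻ v v<p = ≮⇒≥ (<-asym v<p ∘ punchIn-< v)


lookup-ext : ∀ {A : Set} {n} {xs ys : Vec A n} → (∀ i → lookup xs i ≡ lookup ys i) → xs ≡ ys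
lookup-ext {xs = xs} {ys} eq =
  trans (sym (tabulate∘lookup xs)) (trans (tabulate-cong eq) (tabulate∘lookup ys))

ins : ∀ {n} → Fin (suc n) → Vec (Fin n) n → Vec (Fin (suc n)) (suc n)
ins v τ = v ∷ Vec.map (punchIn v) τ

module _ {n} (v : Fin (suc n)) where

  lookup-ins : ∀ τ i → lookup (ins v τ) (suc i) ≡ punchIn v (lookup τ i)
  lookup-ins τ i = lookup-map i (punchIn v) τ

  ins-injective : ∀ {τ τ′} → ins v τ ≡ ins v τ′ → τ ≡ τ′
  ins-injective {τ} {τ′} eq = lookup-ext λ i → punchIn-injective v _ _
    (trans (sym (lookup-ins τ i)) (trans (cong (λ σ → lookup σ (suc i)) eq) (lookup-ins τ′ i)))

  module _ (τ : Vec (Fin n) n) where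

    ins-<⁺ : ∀ {i j} → val τ i < val τ j → val (ins v τ) (suc i) < val (ins v τ) (suc j)
    ins-<⁺ {i} {j} rewrite lookup-ins τ i | lookup-ins τ j = punchIn-mono-< v

    ins-<⁻ : ∀ {i j} → val (ins v τ) (suc i) < val (ins v τ) (suc j) → val τ i < val τ j
    ins-<⁻ {i} {j} rewrite lookup-ins τ i | lookup-ins τ j = punchIn-cancel-< v

    ins-below⁺ : ∀ {i} → val τ i < toℕ v → val (ins v τ) (suc i) < toℕ v
    ins-below⁺ {i} rewrite lookup-ins τ i = punchIn-< v

    ins-below⁻ : ∀ {i} → val (ins v τ) (suc i) < toℕ v → val τ i < toℕ v
    ins-below⁻ {i} rewrite lookup-ins τ i = punchIn-<⁻ v

    ins-above⁺ : ∀ {i} → toℕ v ≤ val τ i → toℕ v < val (ins v τ) (suc i)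
    ins-above⁺ {i} rewrite lookup-ins τ i = punchIn-> v

    ins-above⁻ : ∀ {i} → toℕ v < val (ins v τ) (suc i) → toℕ v ≤ val τ i
    ins-above⁻ {i} rewrite lookup-ins τ i = punchIn->⁻ v

    ins-IsPerm : IsPerm τ → IsPerm (ins v τ)
    ins-IsPerm perm zero zero _ = refl
    ins-IsPerm perm zero (suc j) eq = contradiction (sym (trans eq (lookup-ins τ j))) (punchInᵢ≢i v _)
    ins-IsPerm perm (suc i) zero eq = contradiction (trans (sym (lookup-ins τ i)) eq) (punchInᵢ≢i v _)
    ins-IsPerm perm (suc i) (suc j) eq = cong suc (perm i j (punchIn-injective v _ _
      (trans (sym (lookup-ins τ i)) (trans eq (lookup-ins τ j)))))

    ins-IsPerm⁻ : IsPerm (ins v τ) → IsPerm τ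
    ins-IsPerm⁻ perm i j eq = Fin.suc-injective (perm (suc i) (suc j)
      (trans (lookup-ins τ i) (trans (cong (punchIn v) eq) (sym (lookup-ins τ j)))))

    -- An occurrence whose "3" is the new first entry violates `Adm`; any other lies wholly in `τ`,
    -- as `punchIn v` preserves order. The adjacent pair never uses the new entry, since it stands
    -- to the right of the "3".
    ins-InS : AdmS (toℕ v) τ → InS (ins v τ)
    ins-InS (s , adm) = Avoids⇒InS (ins v τ) (ins-IsPerm (proj₁ s)) av
      where
      av₀ : ∀ {j a b} → Adj j a b → val (ins v τ) (suc a) < toℕ v → toℕ v < val (ins v τ) (suc b) →
            ¬ (∀ k → 0 < toℕ k → toℕ k < suc (toℕ j) → ¬ val (ins v τ) k < val (ins v τ) (suc a))
      av₀ adj a<v v<b none = adm _ _ _ adj (ins-below⁻ a<v) (ins-above⁻ v<b)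
        (λ k k<j k<a → none (suc k) z<s (s<s k<j) (ins-<⁺ k<a))
      av₁ : ∀ i {j a b} → Adj j a b → toℕ i < toℕ j → val (ins v τ) (suc a) < val (ins v τ) (suc i) →
            val (ins v τ) (suc i) < val (ins v τ) (suc b) →
            ¬ (∀ k → suc (toℕ i) < toℕ k → toℕ k < suc (toℕ j) → ¬ val (ins v τ) k < val (ins v τ) (suc a))
      av₁ i adj i<j a<i i<b none = InS⇒Avoids τ s i adj i<j (ins-<⁻ a<i) (ins-<⁻ i<b)
        (λ k i<k k<j k<a → none (suc k) (s<s i<k) (s<s k<j) (ins-<⁺ k<a))
      av : Avoids (ins v τ)
      av zero    {suc j} (rise {suc b} e) _ = av₀ (rise (suc-injective e))
      av zero    {suc j} (fall {suc a} e) _ = av₀ (fall (suc-injective e))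
      av (suc i) {suc j} (rise {suc b} e) (s<s i<j) = av₁ i (rise (suc-injective e)) i<j
      av (suc i) {suc j} (fall {suc a} e) (s<s i<j) = av₁ i (fall (suc-injective e)) i<j

    ins-InS⁻ : InS (ins v τ) → AdmS (toℕ v) τ
    ins-InS⁻ s = Avoids⇒InS τ (ins-IsPerm⁻ (proj₁ s)) av , adm
      where
      av : Avoids τ
      av i adj i<j a<i i<b none = InS⇒Avoids (ins v τ) s (suc i) (Adj-suc adj) (s<s i<j) (ins-<⁺ a<i) (ins-<⁺ i<b)
        λ { (suc k) (s<s i<k) (s<s k<j) k<a → none k i<k k<j (ins-<⁻ k<a) }
      adm : Adm (toℕ v) τ
      adm j a b adj a<v v≤b none = InS⇒Avoids (ins v τ) s zero (Adj-suc adj) z<s (ins-below⁺ a<v) (ins-above⁺ v≤b)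
        λ { (suc k) _ (s<s k<j) k<a → none k k<j (ins-<⁻ k<a) }

ins-surjective : ∀ {n} (σ : Vec (Fin (suc n)) (suc n)) → IsPerm σ → ∃[ τ ] σ ≡ ins (lookup σ zero) τ
ins-surjective (v ∷ xs) perm = τ , cong (v ∷_) (lookup-ext λ i → sym
  (trans (lookup-map i (punchIn v) τ) (trans (cong (punchIn v) (lookup∘tabulate _ i)) (punchIn-punchOut (v≢ i)))))
  where
  v≢ : ∀ i → v ≢ lookup xs i
  v≢ i eq with () ← perm zero (suc i) eq
  τ = tabulate λ i → punchOut (v≢ i)

HeadS : ∀ {n} → ℕ → Vec (Fin (suc n)) (suc n) → Set
HeadS v σ = InS σ × val σ zero ≡ v

Card-HeadS : ∀ {n v m} → v ≤ n → Card (AdmS {n} v) m → Card (HeadS {n} v) m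
Card-HeadS {n} {v} v≤n = Card-image (ins v̂) (ins-injective v̂)
  (λ {τ} s → ins-InS v̂ τ (subst (λ w → AdmS w τ) (sym v̂≡v) s) , v̂≡v)
  λ {σ} (s , h) → let τ , σ≡ = ins-surjective σ (proj₁ s)
                      σ≡′ = trans σ≡ (cong (λ w → ins w τ) (toℕ-injective (trans h (sym v̂≡v))))
                  in τ , subst (λ w → AdmS w τ) v̂≡v (ins-InS⁻ v̂ τ (subst InS σ≡′ s)) , σ≡′
  where
  v̂ = fromℕ< (s≤s v≤n)
  v̂≡v = toℕ-fromℕ< (s≤s v≤n)

HeadS₂ : ∀ {n} → ℕ → Vec (Fin (2 + n)) (2 + n) → Set
HeadS₂ v σ = InS σ × val σ zero ≡ 0 × val σ (suc zero) ≡ suc v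

Adm-0 : ∀ {n} (τ : Vec (Fin n) n) → Adm 0 τ
Adm-0 _ _ _ _ _ ()

Adm-n : ∀ {n} (τ : Vec (Fin n) n) → Adm n τ
Adm-n τ _ _ b _ _ n≤b = contradiction n≤b (<⇒≱ (toℕ<n (lookup τ b)))

-- Prepending 0 is always allowed, since no value lies below the cut 0, and it raises a first entry
-- `v` to `v + 1`.
Card-HeadS₂ : ∀ {n v m} → Card (HeadS {n} v) m → Card (HeadS₂ {n} v) m
Card-HeadS₂ {n} {v} = Card-image (ins zero) (ins-injective zero)
  (λ {τ} (s , h) → ins-InS zero τ (s , Adm-0 τ) , refl , trans (val₁ τ) (cong suc h))
  λ {σ} (s , h₀ , h₁) →
    let τ , σ≡ = ins-surjective σ (proj₁ s)
        σ≡′ = trans σ≡ (cong (λ w → ins w τ) (toℕ-injective h₀))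
    in τ , (proj₁ (ins-InS⁻ zero τ (subst InS σ≡′ s)) ,
            suc-injective (trans (sym (val₁ τ)) (trans (cong (λ ρ → val ρ (suc zero)) (sym σ≡′)) h₁))) , σ≡′
  where
  val₁ : ∀ (τ : Vec (Fin (suc n)) (suc n)) → val (ins zero τ) (suc zero) ≡ suc (val τ zero)
  val₁ (_ ∷ _) = refl

-- Entries up to the position of 0

-- Pigeonhole: if 0 were missed, `punchOut` would inject `n + 1` positions into `n` values.
zero-attained : ∀ {n} (τ : Vec (Fin (suc n)) (suc n)) → IsPerm τ → ∃[ i ] val τ i ≡ 0
zero-attained τ perm with any? (λ i → zero Fin.≟ lookup τ i)
... | yes (i , 0≡τi) = i , cong toℕ (sym 0≡τi)
... | no ¬hit = contradiction
  (injective⇒≤ λ {i} {j} → perm i j ∘ punchOut-injective (avoids i) (avoids j)) 1+n≰n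
  where
  avoids : ∀ i → zero ≢ lookup τ i
  avoids i 0≡τi = ¬hit (i , 0≡τi)

module Prefix {n} (τ : Vec (Fin (suc n)) (suc n)) (s : InS τ) (p : Fin (suc n)) (τp≡0 : val τ p ≡ 0) where

  val-injective : ∀ {i j} → val τ i ≡ val τ j → i ≡ j
  val-injective eq = proj₁ s _ _ (toℕ-injective eq)

  positive : ∀ {i} → i ≢ p → 0 < val τ i
  positive i≢p = n≢0⇒n>0 λ z → i≢p (val-injective (trans z (sym τp≡0)))

  private
    <-not-p : ∀ {i j} → toℕ i < toℕ j → j ≡ p → i ≢ p
    <-not-p i<j refl refl = <-irrefl refl i<j

    module Next {j : Fin (suc n)} {m} (j+1+m≡p : toℕ j + suc m ≡ toℕ p) where
      1+j+m≡p = trans (sym (+-suc (toℕ j) m)) j+1+m≡p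
      j<p : toℕ j < toℕ p
      j<p = subst (toℕ j <_) 1+j+m≡p (s≤s (m≤m+n (toℕ j) m))
      next : Fin (suc n)
      next = fromℕ< (<-≤-trans (s<s j<p) (toℕ<n p))
      next≡ : toℕ next ≡ suc (toℕ j)
      next≡ = toℕ-fromℕ< (<-≤-trans (s<s j<p) (toℕ<n p))
      next+m≡p : toℕ next + m ≡ toℕ p
      next+m≡p = trans (cong (_+ m) next≡) 1+j+m≡p
      <next : ∀ {k : Fin (suc n)} → toℕ k ≤ toℕ j → toℕ k < toℕ next
      <next {k} k≤j = subst (toℕ k <_) (sym next≡) (s≤s k≤j)

    at-p : ∀ {j} → toℕ j + 0 ≡ toℕ p → j ≡ p
    at-p e = toℕ-injective (trans (sym (+-identityʳ _)) e)

    -- Induction on the distance `m` from `j` to `p`. By induction the value at `next` is below all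
    -- earlier ones, so an ascent from `i` to `j` followed by the fall to `next` would be a
    -- forbidden occurrence.
    decreasing′ : ∀ m {i j} → toℕ j + m ≡ toℕ p → toℕ i < toℕ j → val τ j < val τ i
    decreasing′ zero e i<j with refl ← at-p e = subst (_< _) (sym τp≡0) (positive (<-not-p i<j refl))
    decreasing′ (suc m) {i} {j} e i<j with <-cmp (val τ i) (val τ j)
    ... | tri> _ _ j<i = j<i
    ... | tri≈ _ i≡j _ = contradiction i<j (<-irrefl (cong toℕ (val-injective i≡j)))
    ... | tri< i<′j _ _ = contradiction
            (λ k i<k k<j → <-asym (decreasing′ m next+m≡p (<next (<⇒≤ k<j))))
            (InS⇒Avoids τ s i (fall next≡) i<j (decreasing′ m next+m≡p (<next (<⇒≤ i<j))) i<′j)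
      where open Next e

    -- Induction on the distance to `p`: `next` is below the cut, so if `i` were not, the pair would
    -- cross it, and the initial decrease leaves nothing smaller in front.
    below-cut′ : ∀ m {v} → Adm (suc v) τ → ∀ {i} → toℕ i + m ≡ toℕ p → val τ i < suc v
    below-cut′ zero adm e with refl ← at-p e = subst (_< _) (sym τp≡0) z<s
    below-cut′ (suc m) adm {i} e = ≰⇒> λ v<i →
      adm i next i (fall next≡) (below-cut′ m adm next+m≡p) v<i
        (λ k k<i → <-asym (decreasing′ m next+m≡p (<next (<⇒≤ k<i))))
      where open Next e

  decreasing : ∀ {i j} → toℕ i < toℕ j → toℕ j ≤ toℕ p → val τ j < val τ i
  decreasing i<j j≤p = decreasing′ _ (m+[n∸m]≡n j≤p) i<j

  below-cut : ∀ {v} → Adm (suc v) τ → ∀ {i} → toℕ i ≤ toℕ p → val τ i < suc v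
  below-cut adm i≤p = below-cut′ _ adm (m+[n∸m]≡n i≤p)

  -- Every adjacent pair to the right of 0 has 0 itself as its barred entry.
  unblocked : ∀ {j a b} → Adj j a b → (∀ k → toℕ k < toℕ j → ¬ val τ k < val τ a) → toℕ j ≤ toℕ p
  unblocked {j} {a} adj none = ≮⇒≥ λ p<j → none p p<j (subst (_< val τ a) (sym τp≡0) (positive (a≢p adj p<j)))
    where
    a≢p : ∀ {j a b} → Adj j a b → toℕ p < toℕ j → a ≢ p
    a≢p (rise _) p<j refl = <-irrefl refl p<j
    a≢p (fall e) p<j refl = <-asym p<j (≤-reflexive (sym e))

-- The three ways of passing from the cut v + 1 to the cut v + 2

module _ {m} (τ : Vec (Fin (2 + m)) (2 + m)) (s : InS τ) where

  private
    p,τp≡0 = zero-attained τ (proj₁ s)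
    p = proj₁ p,τp≡0
    τp≡0 = proj₂ p,τp≡0
    open Prefix τ s p τp≡0

    one : Fin (2 + m)
    one = suc zero

    zero<p : ∀ {u} → val τ zero ≡ suc u → 0 < toℕ p
    zero<p h = n≢0⇒n>0 λ z → 1+n≢0 (trans (sym h) (trans (cong (val τ) (toℕ-injective {i = zero} (sym z))) τp≡0))

    0<Adj : ∀ {j a b : Fin (2 + m)} → Adj j a b → 0 < toℕ j → 0 < toℕ a
    0<Adj (rise _) 0<j = 0<j
    0<Adj (fall e) _ = subst (0 <_) (sym e) z<s

  module _ {v : ℕ} where

    -- The only new condition concerns pairs with smaller value `v + 1`. If unblocked, such a pair
    -- starts at or before `p`, where all values are at most `v`; but its left member is at least
    -- `v + 1`.
    Adm-step : Adm (1 + v) τ → Adm (2 + v) τ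
    Adm-step adm j a b adj a<2+v 2+v≤b none with m<1+n⇒m<n∨m≡n a<2+v
    ... | inj₁ a<1+v = adm j a b adj a<1+v (≤-trans (n≤1+n _) 2+v≤b) none
    ... | inj₂ a≡1+v with adj
    ...   | rise e = <-irrefl a≡1+v (below-cut adm (unblocked adj none))
    ...   | fall e = <-asym (below-cut adm (unblocked adj none)) 2+v≤b

    -- A crossing pair further right has the first entry `v + 1` strictly between its values, so
    -- avoidance with that entry as "3" applies. The front pair falls and does not cross.
    Adm-head : val τ zero ≡ 1 + v → Adm (2 + v) τ
    Adm-head h zero .zero b (rise e) a<2+v 2+v≤b none =
      <-asym 2+v≤b (subst (val τ b <_) h (decreasing (subst (0 <_) (sym e) z<s) (subst (_≤ toℕ p) (sym e) (zero<p h))))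
    Adm-head h zero a .zero (fall e) a<2+v 2+v≤b none = <-irrefl (sym h) 2+v≤b
    Adm-head h j@(suc _) a b adj a<2+v 2+v≤b none =
      InS⇒Avoids τ s zero adj z<s
        (subst (val τ a <_) (sym h) (≤∧≢⇒< (≤-pred a<2+v) a≢1+v)) (subst (_< val τ b) (sym h) 2+v≤b)
        (λ k _ → none k)
      where
      a≢1+v : val τ a ≢ 1 + v
      a≢1+v eq = <⇒≢ (0<Adj adj z<s) (cong toℕ (val-injective (trans h (sym eq))))

    ¬Adm-head : val τ zero ≡ 1 + v → ¬ Adm (1 + v) τ
    ¬Adm-head h adm = <-irrefl h (below-cut adm z≤n)

    -- The leading 0 blocks every later pair; the front pair has values 0 and `v + 1`, both below
    -- the cut.
    Adm-head₂ : val τ zero ≡ 0 → val τ one ≡ 1 + v → Adm (2 + v) τ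
    Adm-head₂ h₀ h₁ zero .zero b (rise e) a<2+v 2+v≤b none =
      <-irrefl (trans (sym h₁) (cong (val τ) (toℕ-injective {i = one} (sym e)))) 2+v≤b
    Adm-head₂ h₀ h₁ zero a .zero (fall e) a<2+v 2+v≤b none = contradiction (subst (2 + v ≤_) h₀ 2+v≤b) λ ()
    Adm-head₂ h₀ h₁ j@(suc _) a b adj a<2+v 2+v≤b none =
      none zero z<s (subst (_< val τ a) (sym h₀) (n≢0⇒n>0 λ eq →
        <⇒≢ (0<Adj adj z<s) (cong toℕ (val-injective (trans h₀ (sym eq))))))

    ¬Adm-head₂ : val τ zero ≡ 0 → val τ one ≡ 1 + v → ¬ Adm (1 + v) τ
    ¬Adm-head₂ h₀ h₁ adm =
      adm zero zero one (rise refl) (subst (_< 1 + v) (sym h₀) z<s) (≤-reflexive (sym h₁)) (λ _ ())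

    -- The only new condition concerns pairs with larger value `v + 1`. The first entry is smaller
    -- than that, so by the initial decrease `b` lies beyond `p`; an unblocked pair must then be the
    -- rise out of 0.
    Adm-step⁻ : Adm (2 + v) τ → val τ zero ≢ 1 + v → ¬ (val τ zero ≡ 0 × val τ one ≡ 1 + v) → Adm (1 + v) τ
    Adm-step⁻ adm ¬h ¬h₂ j a b adj a<1+v 1+v≤b none with m≤n⇒m<n∨m≡n 1+v≤b
    ... | inj₁ 2+v≤b = adm j a b adj (m<n⇒m<1+n a<1+v) 2+v≤b none
    ... | inj₂ 1+v≡b = refute adj none
      where
      head<1+v : val τ zero < 1 + v
      head<1+v = ≤∧≢⇒< (≤-pred (below-cut adm z≤n)) ¬h

      b≢0 : toℕ b ≢ 0
      b≢0 z = ¬h (trans (cong (val τ) (toℕ-injective {i = zero} (sym z))) (sym 1+v≡b))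

      b≰p : ¬ toℕ b ≤ toℕ p
      b≰p b≤p = <-asym head<1+v (subst (_< val τ zero) (sym 1+v≡b) (decreasing (n≢0⇒n>0 b≢0) b≤p))

      refute : Adj j a b → ¬ (∀ k → toℕ k < toℕ j → ¬ val τ k < val τ a)
      refute (fall e) none = b≰p (unblocked (fall e) none)
      refute (rise e) none with m≤n⇒m<n∨m≡n (unblocked (rise e) none)
      ... | inj₁ j<p = b≰p (subst (_≤ toℕ p) (sym e) j<p)
      ... | inj₂ j≡p with j Fin.≟ zero
      ...   | yes refl = ¬h₂ (j-origin , trans (cong (val τ) (toℕ-injective {i = one} (sym e))) (sym 1+v≡b))
        where
        j-origin : val τ j ≡ 0
        j-origin = trans (cong (val τ) (toℕ-injective {j = p} j≡p)) τp≡0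
      -- The first entry lies strictly between 0 and `v + 1` and serves as the "3".
      ...   | no j≢0 = InS⇒Avoids τ s zero (rise e) 0<j
        (decreasing 0<j (≤-reflexive j≡p)) (subst (val τ zero <_) 1+v≡b head<1+v) (λ k _ → none k)
        where
        0<j : 0 < toℕ j
        0<j = n≢0⇒n>0 (j≢0 ∘ toℕ-injective)

-- The value 0 and a neighbour of it cross the cut 1, and nothing is smaller than 0. The neighbour
-- is the right one if 0 comes first, otherwise the left one.
Adm-1-empty : ∀ {m} (τ : Vec (Fin (2 + m)) (2 + m)) → InS τ → ¬ Adm 1 τ
Adm-1-empty τ s adm with zero-attained τ (proj₁ s)
... | zero , z = adm zero zero (suc zero) (rise refl) (≤-reflexive (cong suc z))
        (Prefix.positive τ s zero z λ ()) (λ _ ())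
... | suc q , z = adm (inject₁ q) (suc q) (inject₁ q) (fall (cong suc (sym (toℕ-inject₁ q))))
        (≤-reflexive (cong suc z)) (Prefix.positive τ s (suc q) z inject₁q≢sucq)
        (λ k _ k<sucq → n≮0 (subst (val τ k <_) z k<sucq))
  where
  inject₁q≢sucq : inject₁ q ≢ suc q
  inject₁q≢sucq eq = 1+n≢n (trans (cong toℕ (sym eq)) (toℕ-inject₁ q))

-- Counting admissible permutations

module Counting (f : ℕ → ℕ) (count : ∀ n → IsCountS n (f n)) where

  -- abstract because comparing unfolded filters makes type checking infeasible
  abstract
    cuts : ℕ → ℕ → ℕ
    cuts n v = length (filter (adm? v) (proj₁ (count n)))

    Card-cuts : ∀ n v → Card (AdmS {n} v) (cuts n v)
    Card-cuts n v = Card-filter (adm? v) (count n)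

  cuts-0 : ∀ n → cuts n 0 ≡ f n
  cuts-0 n = Card-unique (λ τ → mk⇔ proj₁ (_, Adm-0 τ)) (Card-cuts n 0) (count n)

  cuts-n : ∀ n → cuts n n ≡ f n
  cuts-n n = Card-unique (λ τ → mk⇔ proj₁ (_, Adm-n τ)) (Card-cuts n n) (count n)

  cuts-1-empty : ∀ n → cuts (2 + n) 1 ≡ 0
  cuts-1-empty n = Card-unique {Q = λ _ → ⊥} (λ τ → mk⇔ (λ (s , adm) → Adm-1-empty τ s adm) λ ())
    (Card-cuts (2 + n) 1) ([] , [] , refl , λ _ → mk⇔ (λ ()) λ ())

  -- Deleting `v + 1` from the front leaves length `m + 1` at the cut `v + 1`; deleting 0 and then
  -- the standardized entry `v` leaves length `m` at the cut `v`.
  cuts-step : ∀ {m v} → v ≤ m → cuts (2 + m) (2 + v) ≡ cuts (2 + m) (1 + v) + (cuts (1 + m) (1 + v) + cuts m v)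
  cuts-step {m} {v} v≤m = Card-unique
    (λ τ → mk⇔ (to τ) (from τ))
    (Card-cuts (2 + m) (2 + v))
    (Card-⊎ (λ { {τ} (s , adm) (inj₁ (_ , h)) → ¬Adm-head τ s h adm
               ; {τ} (s , adm) (inj₂ (_ , h₀ , h₁)) → ¬Adm-head₂ τ s h₀ h₁ adm })
      (Card-cuts (2 + m) (1 + v))
      (Card-⊎ (λ (_ , h) (_ , h₀ , _) → 1+n≢0 (trans (sym h) h₀))
        (Card-HeadS (s≤s v≤m) (Card-cuts (1 + m) (1 + v)))
        (Card-HeadS₂ (Card-HeadS v≤m (Card-cuts m v)))))
    where
    to : ∀ τ → AdmS (2 + v) τ → AdmS (1 + v) τ ⊎ HeadS (1 + v) τ ⊎ HeadS₂ v τ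
    to τ (s , adm) with val τ zero ≟ 1 + v
    ... | yes h = inj₂ (inj₁ (s , h))
    ... | no ¬h with val τ zero ≟ 0 ×-dec val τ (suc zero) ≟ 1 + v
    ...   | yes h₂ = inj₂ (inj₂ (s , h₂))
    ...   | no ¬h₂ = inj₁ (s , Adm-step⁻ τ s adm ¬h ¬h₂)

    from : ∀ τ → AdmS (1 + v) τ ⊎ HeadS (1 + v) τ ⊎ HeadS₂ v τ → AdmS (2 + v) τ
    from τ (inj₁ (s , adm)) = s , Adm-step τ s adm
    from τ (inj₂ (inj₁ (s , h))) = s , Adm-head τ s h
    from τ (inj₂ (inj₂ (s , h₀ , h₁))) = s , Adm-head₂ τ s h₀ h₁

  f-0 : f 0 ≡ 1
  f-0 = Card-unique {Q = λ _ → ⊤} (λ { [] → mk⇔ (λ _ → tt) λ _ → (λ ()) , (λ ()) , (λ ()) }) (count 0)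
    (([] ∷ []) , [] ∷ [] , refl , λ { [] → mk⇔ (λ _ → tt) λ _ → here refl })

  f-1 : f 1 ≡ 1
  f-1 = trans (Card-unique {Q = HeadS 0}
    (λ { σ@(zero ∷ []) → mk⇔ (_, refl) proj₁ }) (count 1) (Card-HeadS z≤n (Card-cuts 0 0)))
    (trans (cuts-0 0) f-0)

-- Fibonacci convolutions

Σ<≡ : ∀ n g → Σ< n g ≡ sum (applyUpTo g n)
Σ<≡ n g = cong sum (map-upTo g n)

Σ<-head : ∀ n g → Σ< (suc n) g ≡ g 0 + Σ< n (g ∘ suc)
Σ<-head n g = trans (Σ<≡ (suc n) g) (cong (g 0 +_) (sym (Σ<≡ n (g ∘ suc))))

Σ<-last : ∀ n g → Σ< (suc n) g ≡ Σ< n g + g n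
Σ<-last zero g = +-comm (g 0) 0
Σ<-last (suc n) g = begin
  Σ< (2 + n) g                          ≡⟨ Σ<-head (suc n) g ⟩
  g 0 + Σ< (suc n) (g ∘ suc)            ≡⟨ cong (g 0 +_) (Σ<-last n (g ∘ suc)) ⟩
  g 0 + (Σ< n (g ∘ suc) + g (suc n))    ≡⟨ +-assoc (g 0) _ _ ⟨
  g 0 + Σ< n (g ∘ suc) + g (suc n)      ≡⟨ cong (_+ g (suc n)) (Σ<-head n g) ⟨
  Σ< (suc n) g + g (suc n)              ∎

Σ<-cong : ∀ n {g h} → (∀ k → k < n → g k ≡ h k) → Σ< n g ≡ Σ< n h
Σ<-cong zero eq = refl
Σ<-cong (suc n) {g} {h} eq = trans (Σ<-last n g) (trans
  (cong₂ _+_ (Σ<-cong n λ k k<n → eq k (m<n⇒m<1+n k<n)) (eq n ≤-refl)) (sym (Σ<-last n h)))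

Σ<-+ : ∀ n g h → Σ< n (λ k → g k + h k) ≡ Σ< n g + Σ< n h
Σ<-+ zero g h = refl
Σ<-+ (suc n) g h = begin
  Σ< (suc n) (λ k → g k + h k)          ≡⟨ Σ<-last n _ ⟩
  Σ< n (λ k → g k + h k) + (g n + h n)  ≡⟨ cong (_+ (g n + h n)) (Σ<-+ n g h) ⟩
  Σ< n g + Σ< n h + (g n + h n)         ≡⟨ interchange (Σ< n g) _ _ _ ⟩
  (Σ< n g + g n) + (Σ< n h + h n)       ≡⟨ cong₂ _+_ (Σ<-last n g) (Σ<-last n h) ⟨
  Σ< (suc n) g + Σ< (suc n) h           ∎
  where
  interchange : ∀ a b c d → a + b + (c + d) ≡ (a + c) + (b + d)
  interchange = solve-∀

compSum-0 : ∀ p → compSum p 0 ≡ 1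
compSum-0 zero = refl
compSum-0 (suc p) = trans (+-identityʳ _) (trans (+-identityʳ _) (compSum-0 p))

-- (1 - z - z²) P^(p+1) = P^p for the Fibonacci series P, coefficientwise.
compSum-1 : ∀ p → compSum (suc p) 1 ≡ compSum p 1 + compSum (suc p) 0
compSum-1 p = cong (_+ compSum (suc p) 0) (+-identityʳ (compSum p 1))

compSum-step : ∀ p t → compSum (suc p) (2 + t) ≡ compSum p (2 + t) + (compSum (suc p) (1 + t) + compSum (suc p) t)
compSum-step p t = begin
  compSum (suc p) (2 + t)
    ≡⟨ Σ<-head (2 + t) (λ m → fib m * c (2 + t ∸ m)) ⟩
  1 * c (2 + t) + Σ< (2 + t) (λ m → fib (1 + m) * c (1 + t ∸ m))
    ≡⟨ cong₂ _+_ (*-identityˡ (c (2 + t))) (Σ<-head (1 + t) (λ m → fib (1 + m) * c (1 + t ∸ m))) ⟩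
  c (2 + t) + (1 * c (1 + t) + Σ< (1 + t) (λ m → fib (2 + m) * c (t ∸ m)))
    ≡⟨ cong (λ x → c (2 + t) + (1 * c (1 + t) + x)) (Σ<-cong (1 + t) λ m _ → *-distribʳ-+ (c (t ∸ m)) (fib (1 + m)) (fib m)) ⟩
  c (2 + t) + (1 * c (1 + t) + Σ< (1 + t) (λ m → fib (1 + m) * c (t ∸ m) + fib m * c (t ∸ m)))
    ≡⟨ cong (λ x → c (2 + t) + (1 * c (1 + t) + x)) (Σ<-+ (1 + t) (λ m → fib (1 + m) * c (t ∸ m)) (λ m → fib m * c (t ∸ m))) ⟩
  c (2 + t) + (1 * c (1 + t) + (Σ< (1 + t) (λ m → fib (1 + m) * c (t ∸ m)) + compSum (suc p) t))
    ≡⟨ cong (c (2 + t) +_) (+-assoc (1 * c (1 + t)) _ _) ⟨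
  c (2 + t) + (1 * c (1 + t) + Σ< (1 + t) (λ m → fib (1 + m) * c (t ∸ m)) + compSum (suc p) t)
    -- The term split off earlier is the one for `m = 0`, as `fib 1 = fib 0`.
    ≡⟨ cong (λ x → c (2 + t) + (x + compSum (suc p) t)) (Σ<-head (1 + t) (λ m → fib m * c (1 + t ∸ m))) ⟨
  c (2 + t) + (compSum (suc p) (1 + t) + compSum (suc p) t)
    ∎
  where c = compSum p

module Weighted (f : ℕ → ℕ) where

  -- With P = 1/(1 - z - z²), this is the coefficient of z^t in the sum over i of z^i P^(p+i)
  -- f(d+i). The recursive form lets its recurrence be proved by induction on `t`.
  S : ℕ → ℕ → ℕ → ℕ
  S p zero d = compSum p 0 * f d
  S p (suc t) d = compSum p (suc t) * f d + S (suc p) t (suc d)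

  S≡Σ< : ∀ p t d → S p t d ≡ Σ< (suc t) (λ i → compSum (p + i) (t ∸ i) * f (d + i))
  S≡Σ< p zero d rewrite +-identityʳ p | +-identityʳ d = sym (+-identityʳ _)
  S≡Σ< p (suc t) d = sym (begin
    Σ< (2 + t) (λ i → compSum (p + i) (suc t ∸ i) * f (d + i))
      ≡⟨ Σ<-head (suc t) (λ i → compSum (p + i) (suc t ∸ i) * f (d + i)) ⟩
    compSum (p + 0) (suc t) * f (d + 0) + Σ< (suc t) (λ i → compSum (p + suc i) (t ∸ i) * f (d + suc i))
      ≡⟨ cong₂ _+_ (cong₂ (λ q e → compSum q (suc t) * f e) (+-identityʳ p) (+-identityʳ d))
           (Σ<-cong (suc t) λ i _ → cong₂ (λ q e → compSum q (t ∸ i) * f e) (+-suc p i) (+-suc d i)) ⟩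
    compSum p (suc t) * f d + Σ< (suc t) (λ i → compSum (suc p + i) (t ∸ i) * f (suc d + i))
      ≡⟨ cong (compSum p (suc t) * f d +_) (S≡Σ< (suc p) t (suc d)) ⟨
    S p (suc t) d
      ∎)

  S-1 : ∀ p d → S (suc p) 1 d ≡ S p 1 d + S (suc p) 0 d
  S-1 p d = begin
    compSum (suc p) 1 * f d + compSum (2 + p) 0 * f (suc d)
      ≡⟨ cong₂ (λ x y → x * f d + y * f (suc d)) (compSum-1 p) (trans (compSum-0 (2 + p)) (sym (compSum-0 (suc p)))) ⟩
    (compSum p 1 + compSum (suc p) 0) * f d + compSum (suc p) 0 * f (suc d)
      ≡⟨ regroup (compSum p 1) (compSum (suc p) 0) (f d) (compSum (suc p) 0 * f (suc d)) ⟩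
    compSum p 1 * f d + compSum (suc p) 0 * f (suc d) + compSum (suc p) 0 * f d
      ∎
    where
    regroup : ∀ x y w z → (x + y) * w + z ≡ x * w + z + y * w
    regroup = solve-∀

  -- Multiplication by 1 - z - z² again lowers the exponent of P by one: `compSum-step` handles the
  -- leading term, induction with `p` and `d` raised by one the others.
  S-step : ∀ p t d → S (suc p) (2 + t) d ≡ S p (2 + t) d + (S (suc p) (1 + t) d + S (suc p) t d)
  S-step p t d = begin
    compSum (suc p) (2 + t) * f d + S (2 + p) (1 + t) (suc d)
      ≡⟨ cong₂ (λ x y → x * f d + y) (compSum-step p t) (tail t) ⟩
    (compSum p (2 + t) + (compSum (suc p) (1 + t) + compSum (suc p) t)) * f d
      + (S (suc p) (1 + t) (suc d) + (S (2 + p) t (suc d) + rest t))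
      ≡⟨ regroup (compSum p (2 + t)) (compSum (suc p) (1 + t)) (compSum (suc p) t) (f d) _ _ (rest t) ⟩
    S p (2 + t) d + (S (suc p) (1 + t) d + (compSum (suc p) t * f d + rest t))
      ≡⟨ cong (λ x → S p (2 + t) d + (S (suc p) (1 + t) d + x)) (rest≡ t) ⟩
    S p (2 + t) d + (S (suc p) (1 + t) d + S (suc p) t d)
      ∎
    where
    -- The part of `S (suc p) t d` after its leading term, which is empty for `t = 0`.
    rest : ℕ → ℕ
    rest zero = 0
    rest (suc t) = S (2 + p) t (suc d)

    rest≡ : ∀ t → compSum (suc p) t * f d + rest t ≡ S (suc p) t d
    rest≡ zero = +-identityʳ _
    rest≡ (suc t) = refl

    tail : ∀ t → S (2 + p) (1 + t) (suc d) ≡ S (suc p) (1 + t) (suc d) + (S (2 + p) t (suc d) + rest t)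
    tail zero = trans (S-1 (suc p) (suc d)) (cong (S (suc p) 1 (suc d) +_) (sym (+-identityʳ _)))
    tail (suc t) = S-step (suc p) t (suc d)

    regroup : ∀ x y z w u v r → (x + (y + z)) * w + (u + (v + r)) ≡ x * w + u + (y * w + v + (z * w + r))
    regroup = solve-∀

a-≤ : ∀ {n k} → k ≤ n → a (2 + n) k ≡ compSum (suc k) (n ∸ k)
a-≤ {n} {k} k≤n with 2 + k ≤? 2 + n
... | yes _ = refl
... | no 2+k≰2+n = contradiction (s≤s (s≤s k≤n)) 2+k≰2+n

a-> : ∀ {n k} → n < 2 + k → a n k ≡ 0
a-> {n} {k} n<2+k with 2 + k ≤? n
... | yes 2+k≤n = contradiction 2+k≤n (<⇒≱ n<2+k)
... | no _ = refl

-- Solving the recurrence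

module Recurrence (f : ℕ → ℕ) (count : ∀ n → IsCountS n (f n)) where
  open Counting f count
  open Weighted f

  -- By Card-HeadS, the number of σ in S_{s+d+1} whose first entry exceeds s entries and is exceeded by d.
  h : ℕ → ℕ → ℕ
  h s d = cuts (s + d) s

  h-step : ∀ s d → h (2 + s) d ≡ h (1 + s) (1 + d) + (h (1 + s) d + h s d)
  h-step s d rewrite +-suc s d = cuts-step (m≤m+n s d)

  -- The Iverson factor `[d = 0]`, needed because `h 1 d` vanishes except at `d = 0`.
  ifZero : ℕ → ℕ → ℕ
  ifZero zero x = x
  ifZero (suc _) _ = 0

  ifZero-+ : ∀ d x y → ifZero d (x + y) ≡ ifZero d x + ifZero d y
  ifZero-+ zero _ _ = refl
  ifZero-+ (suc _) _ _ = refl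

  T : ℕ → ℕ → ℕ
  T zero d = 0
  T (suc n) d = S 1 n d

  -- This is the case `p = 0`: `compSum 0 (suc t)` computes to 0, so `S 0 (suc t) d` reduces to
  -- `S 1 t (suc d)`.
  T-step : ∀ n d → T (2 + n) d ≡ T (1 + n) (1 + d) + (T (1 + n) d + T n d)
  T-step zero d = trans (S-1 0 d) (cong (S 1 0 (1 + d) +_) (sym (+-identityʳ _)))
  T-step (suc n) d = S-step 0 n d

  h-formula : ∀ n d → h (1 + n) d ≡ ifZero d (fib n) + T n d
  h-formula zero zero = trans (cuts-n 1) f-1
  h-formula zero (suc d) = cuts-1-empty d
  -- A separate base case: the recurrence reaches `h 0 d = f d`, to which the formula does not
  -- extend.
  h-formula (suc zero) d = begin
    h 2 d                            ≡⟨ h-step 0 d ⟩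
    h 1 (1 + d) + (h 1 d + h 0 d)    ≡⟨ cong₂ (λ x y → x + (y + h 0 d)) (h-formula 0 (1 + d)) (h-formula 0 d) ⟩
    ifZero d 1 + 0 + h 0 d           ≡⟨ cong₂ _+_ (+-identityʳ _) (cuts-0 d) ⟩
    ifZero d 1 + f d                 ≡⟨ cong (ifZero d 1 +_) (*-identityˡ (f d)) ⟨
    ifZero d 1 + T 1 d               ∎
  h-formula (suc (suc n)) d = begin
    h (3 + n) d
      ≡⟨ h-step (1 + n) d ⟩
    h (2 + n) (1 + d) + (h (2 + n) d + h (1 + n) d)
      ≡⟨ cong₂ _+_ (h-formula (suc n) (1 + d)) (cong₂ _+_ (h-formula (suc n) d) (h-formula n d)) ⟩
    T (1 + n) (1 + d) + (ifZero d (fib (1 + n)) + T (1 + n) d + (ifZero d (fib n) + T n d))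
      ≡⟨ regroup (T (1 + n) (1 + d)) (ifZero d (fib (1 + n))) (T (1 + n) d) (ifZero d (fib n)) (T n d) ⟩
    ifZero d (fib (1 + n)) + ifZero d (fib n) + (T (1 + n) (1 + d) + (T (1 + n) d + T n d))
      ≡⟨ cong₂ _+_ (ifZero-+ d (fib (1 + n)) (fib n)) (T-step n d) ⟨
    ifZero d (fib (2 + n)) + T (2 + n) d
      ∎
    where
    regroup : ∀ x a y b z → x + (a + y + (b + z)) ≡ a + b + (x + (y + z))
    regroup = solve-∀

  Σ<-a : ∀ n → Σ< (2 + n) (λ k → a (2 + n) k * f k) ≡ S 1 n 0
  Σ<-a n = begin
    Σ< (2 + n) (λ k → a (2 + n) k * f k)
      ≡⟨ Σ<-last (1 + n) (λ k → a (2 + n) k * f k) ⟩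
    Σ< (1 + n) (λ k → a (2 + n) k * f k) + a (2 + n) (1 + n) * f (1 + n)
      -- The column `k = n + 1` fails `k + 2 ≤ n + 2` and contributes 0.
      ≡⟨ cong₂ _+_ (Σ<-cong (1 + n) λ { k (s≤s k≤n) → cong (_* f k) (a-≤ k≤n) })
                   (cong (_* f (1 + n)) (a-> {2 + n} {1 + n} ≤-refl)) ⟩
    Σ< (1 + n) (λ k → compSum (1 + k) (n ∸ k) * f k) + 0
      ≡⟨ +-identityʳ _ ⟩
    Σ< (1 + n) (λ k → compSum (1 + k) (n ∸ k) * f k)
      ≡⟨ S≡Σ< 1 n 0 ⟨
    S 1 n 0
      ∎

-- This is X = F + AX row by row. Since A is strictly lower triangular, row `n` involves only
-- `k < n`, and I - A is invertible, so the system is the claimed X = (I - A)^(-1) F.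
mainTheorem10 : (f : ℕ → ℕ) → ((n : ℕ) → IsCountS n (f n)) →
    (n : ℕ) → f n ≡ Fvec n + Σ< n (λ k → a n k * f k)
mainTheorem10 f count zero = Counting.f-0 f count
mainTheorem10 f count (suc zero) = Counting.f-1 f count
mainTheorem10 f count (suc (suc n)) = begin
  f (2 + n)                                                    ≡⟨ cuts-n (2 + n) ⟨
  cuts (2 + n) (2 + n)                                         ≡⟨ cong (λ m → cuts m (2 + n)) (+-identityʳ (2 + n)) ⟨
  h (2 + n) 0                                                  ≡⟨ h-formula (1 + n) 0 ⟩
  fib (1 + n) + S 1 n 0                                        ≡⟨ cong (fib (1 + n) +_) (Σ<-a n) ⟨
  fib (1 + n) + Σ< (2 + n) (λ k → a (2 + n) k * f k)           ∎
  where
  open Counting f count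
  open Weighted f
  open Recurrence f count
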